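{- Let $s,t$ be integers and $p$ a prime such that $s=p^as'$ and $t=p^bt'$, where $s',t'$ are integers with $p\nmid s't'$, $a$ is a positive integer, and $b$ is a positive integer or $b=\infty$ (where $b=\infty$ means $t=0$), with $b\ge 2a$. Then for all $n\ge 2$, \[ v_p(P_n)=\begin{cases}\varphi(n)\,a & \text{if } b>2a,\\ \varphi(n)\,a+v_p(P'_n) & \text{if } b=2a,\end{cases} \] where $(P_n)_{n\ge1}$ is the sequence of Lucas atoms associated with $(s,t)$ and $(P'_n)_{n\ge 1}$ is the sequence of Lucas atoms associated with $(s',t')$, i.e. with the Lucas sequence having characteristic polynomial $X^2-s'X-t'$.
   Context: Lucas atoms: for $n\ge 1$ let $\Phi_n(\alpha,\beta)=\prod_{1\le j\le n,\ \gcd(j,n)=1}(\alpha-\omega^j\beta)$, with $\omega$ a primitive $n$-th root of unity (the homogenization of the $n$-th cyclotomic polynomial). Put $P_1(s,t)=1$, and for $n\ge 2$ let $P_n(s,t)\in\mathbb Z[s,t]$ be the unique polynomial with $P_n(\alpha+\beta,-\alpha\beta)=\Phi_n(\alpha,\beta)$ as polynomials in the variables $\alpha,\beta$. For integers $s,t$, the sequence of Lucas atoms associated with $(s,t)$ is the sequence of integer values $P_n=P_n(s,t)$; thus $P'_n=P_n(s',t')$. $v_p$ is the $p$-adic valuation, with $v_p(0)=+\infty$; $\varphi$ is Euler's totient function. -}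

module Defs where

open import Algebra.Apartness.Bundles using (HeytingField; HeytingCommutativeRing)
open import Algebra.Bundles using (CommutativeRing)
open import Algebra.Bundles.Raw using (RawRing)
import Algebra.Definitions.RawSemiring as RawSemiringDefs
open import Data.Bool.Base using (if_then_else_)
open import Data.Integer.Base as ℤ using (ℤ; +_; -[1+_])
open import Data.List.Base using (List; []; _∷_; map; foldr; filter; length; applyUpTo)
open import Data.Nat.Base as ℕ using (ℕ; zero; suc)
open import Data.Nat.Divisibility using (_∣?_)
open import Data.Nat.GCD using (gcd)
import Data.Nat.Properties as ℕₚ
open import Data.Product.Base using (_×_)
open import Level as Level using (Level)
open import Relation.Nullary using (¬_; does)
open import Relation.Nullary.Construct.Add.Supremum using (_⁺; [_]; ⊤⁺)

open import Relation.Binary.Construct.Add.Supremum.NonStrict ℕ._≤_ public using (_≤⁺_)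
open import Relation.Binary.Construct.Add.Supremum.Strict ℕ._<_ public using (_<⁺_)

private
  variable
    c ℓ ℓ₁ ℓ₂ : Level

infixl 6 _+⁺_
_+⁺_ : ℕ ⁺ → ℕ ⁺ → ℕ ⁺
[ m ] +⁺ [ n ] = [ m ℕ.+ n ]
[ _ ] +⁺ ⊤⁺    = ⊤⁺
⊤⁺    +⁺ _     = ⊤⁺

-- Powers of a prime with exponent in ℕ ∪ {∞}, where p^∞ = 0.
infixr 8 _^⁺_
_^⁺_ : ℕ → ℕ ⁺ → ℤ
p ^⁺ [ b ] = + (p ℕ.^ b)
p ^⁺ ⊤⁺    = + 0

-- maxExponent p m N is the greatest k ≤ N such that p^k divides m.
maxExponent : ℕ → ℕ → ℕ → ℕ
maxExponent p m zero    = 0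
maxExponent p m (suc k) =
  if does (p ℕ.^ suc k ∣? m) then suc k else maxExponent p m k

-- For p ≥ 2 and m ≥ 1, p^k ∣ m forces k < m, so searching up to m suffices.
v : ℕ → ℤ → ℕ ⁺
v p (+ zero)   = ⊤⁺
v p (+ suc m)  = [ maxExponent p (suc m) (suc m) ]
v p -[1+ m ]   = [ maxExponent p (suc m) (suc m) ]

coprimesUpTo : ℕ → List ℕ
coprimesUpTo n = filter (λ j → gcd j n ℕₚ.≟ 1) (applyUpTo suc n)

φ : ℕ → ℕ
φ n = length (coprimesUpTo n)

-- Univariate polynomials as coefficient lists, constant term first.  Equality
-- is coefficientwise, so trailing zeros are irrelevant.
module _ (R : RawRing c ℓ) where
  open RawRing R

  coeff : List Carrier → ℕ → Carrier
  coeff []      _       = 0#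
  coeff (a ∷ _) zero    = a
  coeff (_ ∷ p) (suc n) = coeff p n

  addPoly : List Carrier → List Carrier → List Carrier
  addPoly []      q       = q
  addPoly (a ∷ p) []      = a ∷ p
  addPoly (a ∷ p) (b ∷ q) = (a + b) ∷ addPoly p q

  mulPoly : List Carrier → List Carrier → List Carrier
  mulPoly []      q = []
  mulPoly (a ∷ p) q = addPoly (map (a *_) q) (0# ∷ mulPoly p q)

  infix 9 _[X]
  _[X] : RawRing c ℓ
  _[X] = record
    { Carrier = List Carrier
    ; _≈_     = λ p q → ∀ n → coeff p n ≈ coeff q n
    ; _+_     = addPoly
    ; _*_     = mulPoly
    ; -_      = map (-_)
    ; 0#      = []
    ; 1#      = 1# ∷ []
    }

module _ (R : RawRing c ℓ) where
  open RawRing R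

  -- Bivariate polynomials are polynomials in the second variable whose
  -- coefficients are polynomials in the first.
  _[X,Y] : RawRing c ℓ
  _[X,Y] = (R [X]) [X]

  const : Carrier → RawRing.Carrier _[X,Y]
  const a = (a ∷ []) ∷ []

  varX varY : RawRing.Carrier _[X,Y]
  varX = (0# ∷ 1# ∷ []) ∷ []
  varY = [] ∷ (1# ∷ []) ∷ []

ℤ[s,t] : RawRing _ _
ℤ[s,t] = ℤ.+-*-rawRing [X,Y]

module _ (A : RawRing c ℓ) where
  open RawRing A
  open RawSemiringDefs rawSemiring using () renaming (_×_ to _·_)

  fromℤ : ℤ → Carrier
  fromℤ (+ n)    = n · 1#
  fromℤ -[1+ n ] = - (suc n · 1#)

  evalPoly : {C : Set} → (C → Carrier) → Carrier → List C → Carrier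
  evalPoly f x = foldr (λ a r → f a + x * r) 0#

  eval : RawRing.Carrier ℤ[s,t] → Carrier → Carrier → Carrier
  eval P x y = evalPoly (evalPoly fromℤ x) y P

evalℤ : RawRing.Carrier ℤ[s,t] → ℤ → ℤ → ℤ
evalℤ = eval ℤ.+-*-rawRing

module _ (R : RawRing c ℓ) where
  open RawRing R using (_≈_; 1#; rawSemiring) renaming (Carrier to ∣R∣)
  open RawSemiringDefs rawSemiring using (_^_)
  open RawRing (R [X,Y]) using (_+_; _*_; -_)
    renaming (Carrier to R[α,β]; 1# to 1[α,β]; _≈_ to _≈[α,β]_)

  PrimitiveRoot : ℕ → ∣R∣ → Set ℓ
  PrimitiveRoot n ω =
    (ω ^ n ≈ 1#) × (∀ k → 1 ℕ.≤ k → k ℕ.< n → ¬ (ω ^ k ≈ 1#))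

  private
    α β : R[α,β]
    α = varX R
    β = varY R

  Φ : ∣R∣ → ℕ → R[α,β]
  Φ ω n = foldr _*_ 1[α,β]
    (map (λ j → α + - (const R (ω ^ j) * β)) (coprimesUpTo n))

  -- P n is the polynomial Pₙ(s,t) defined by Pₙ(α+β,-αβ) = Φₙ(α,β), an identity
  -- in R[α,β].  As α+β and -αβ are algebraically independent, it determines
  -- P n up to the equality of ℤ[s,t] when R has characteristic zero.
  record AreLucasAtoms (ω : ℕ → ∣R∣) (P : ℕ → RawRing.Carrier ℤ[s,t]) : Set ℓ where
    field
      P₁ : RawRing._≈_ ℤ[s,t] (P 1) (RawRing.1# ℤ[s,t])
      Pₙ : ∀ n → 2 ℕ.≤ n →
           eval (R [X,Y]) (P n) (α + β) (- (α * β)) ≈[α,β] Φ (ω n) n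

module _ (K : HeytingField c ℓ₁ ℓ₂) where
  open HeytingField K

  fieldRawRing : RawRing c ℓ₁
  fieldRawRing = CommutativeRing.rawRing
    (HeytingCommutativeRing.commutativeRing heytingCommutativeRing)

  open RawSemiringDefs (RawRing.rawSemiring fieldRawRing) using () renaming (_×_ to _·_)

  CharacteristicZero : Set ℓ₁
  CharacteristicZero = ∀ n → ¬ (suc n · 1# ≈ 0#)

-- A field of characteristic zero containing primitive roots of unity of every
-- order, such as ℂ; the Lucas atoms do not depend on the choice of this field
-- or of the roots.
record FieldWithRootsOfUnity c ℓ₁ ℓ₂ : Set (Level.suc (c Level.⊔ ℓ₁ Level.⊔ ℓ₂)) where
  field
    heytingField       : HeytingField c ℓ₁ ℓ₂
    characteristicZero : CharacteristicZero heytingField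

  rawRing : RawRing c ℓ₁
  rawRing = fieldRawRing heytingField

  open RawRing rawRing public using (Carrier)

  field
    ζ         : ℕ → Carrier
    ζ-order   : ∀ n → 1 ℕ.≤ n → PrimitiveRoot rawRing n (ζ n)

  LucasAtomPolynomials : (ℕ → RawRing.Carrier ℤ[s,t]) → Set ℓ₁
  LucasAtomPolynomials = AreLucasAtoms rawRing ζ

{-# OPTIONS --safe #-}

-- The identity Pₙ(α+β, −αβ) = Φₙ(α,β) may be evaluated in every commutative
-- algebra S over the ground field.  In S = R[X]/(X² − s X − t) the elements
-- α = X and β = s − X satisfy α+β = s and −αβ = t, and every factor α − ω^j β is
-- linear in (α,β); hence Pₙ(l s, l² t) = l^φ(n) Pₙ(s,t), and β = 0 gives
-- Pₙ(s,0) = s^φ(n).  In characteristic zero both descend to ℤ.  With l = p^a and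
-- t = p^(2a) u the valuation is φ(n) a + v_p(Pₙ(s′,u)), which settles b = 2a,
-- and if b > 2a then p ∣ u, so Pₙ(s′,u) ≡ s′^φ(n) is prime to p.
module Submission where

open import Defs
open import Algebra.Apartness.Bundles using (HeytingField; HeytingCommutativeRing)
open import Algebra.Bundles using (AbelianGroup; CommutativeRing)
open import Algebra.Bundles.Raw using (RawRing)
open import Algebra.Consequences.Setoid using (comm∧distrˡ⇒distrʳ; comm∧idˡ⇒idʳ)
import Algebra.Construct.DirectProduct as DirectProduct
import Algebra.Definitions.RawSemiring as RawSemiringDefs
open import Algebra.Morphism.Construct.Identity using (isRingHomomorphism)
open import Algebra.Morphism.Structures using (module RingMorphisms)
import Algebra.Properties.AbelianGroup as AbelianGroupProperties
import Algebra.Properties.CommutativeSemigroup as CommutativeSemigroupProperties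
import Algebra.Properties.Group as GroupProperties
import Algebra.Properties.Monoid.Mult as MonoidMult
import Algebra.Properties.Ring as RingProperties
import Algebra.Properties.Semiring.Mult as SemiringMult
import Algebra.Solver.Ring.NaturalCoefficients.Default as SemiringSolver
open import Data.Integer as ℤ using (ℤ; +_; -[1+_])
import Data.Integer.Divisibility.Signed as Signed
open import Data.Integer.Divisibility using (_∣_)
import Data.Integer.Properties as ℤₚ
open import Data.List using (List; []; _∷_; foldr; length; map)
open import Data.Nat as ℕ using (ℕ; zero; suc; z≤n; s≤s; NonZero)
import Data.Nat.Divisibility as ℕ∣
open import Data.Nat.Primality using (Prime; prime⇒nonTrivial; euclidsLemma)
import Data.Nat.Properties as ℕₚ
open import Data.Product using (_×_; _,_; proj₁)
import Data.Sign as Sign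
open import Data.Sum using ([_,_]′)
open import Function using (_∘_)
open import Level using (Level)
open import Relation.Binary.Construct.Add.Supremum.Strict ℕ._<_ using ([<]-injective)
open import Relation.Binary.PropositionalEquality as ≡ using (_≡_; module ≡-Reasoning)
import Relation.Binary.Reasoning.Setoid as SetoidReasoning
open import Relation.Nullary using (¬_; yes; no; contradiction)
open import Relation.Nullary.Construct.Add.Supremum using (_⁺; [_]; ⊤⁺)

private
  variable
    c c′ ℓ ℓ′ : Level

-- Ring homomorphisms out of raw rings.

module _ (R : RawRing c ℓ) (S : CommutativeRing c′ ℓ′) where
  private
    module R = RawRing R
    module S = CommutativeRing S
  open RingMorphisms R S.rawRing

  -- The source carries operations but no laws, so that `R [X]` and `R [X,Y]` can be sources as raw
  -- rings; every equation is then proved in the commutative target.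
  ringHomomorphism : {f : R.Carrier → S.Carrier} →
    (∀ {x y} → x R.≈ y → f x S.≈ f y) →
    (∀ x y → f (x R.+ y) S.≈ f x S.+ f y) →
    (∀ x y → f (x R.* y) S.≈ f x S.* f y) →
    (∀ x → f (R.- x) S.≈ S.- f x) →
    f R.0# S.≈ S.0# →
    f R.1# S.≈ S.1# →
    IsRingHomomorphism f
  ringHomomorphism cong +-homo *-homo -‿homo 0#-homo 1#-homo = record
    { isSemiringHomomorphism = record
      { isNearSemiringHomomorphism = record
        { +-isMonoidHomomorphism = record
          { isMagmaHomomorphism = record
            { isRelHomomorphism = record { cong = cong }
            ; homo = +-homo
            }
          ; ε-homo = 0#-homo
          }
        ; *-homo = *-homo
        }
      ; 1#-homo = 1#-homo
      }
    ; -‿homo = -‿homo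
    }

-- The canonical homomorphism from the integers.

module FromℤHomomorphism (R : CommutativeRing c ℓ) where
  open CommutativeRing R
  open RingProperties ring using (-‿distribˡ-*; -‿distribʳ-*)
  open AbelianGroupProperties +-abelianGroup
    using (⁻¹-∙-comm; ⁻¹-involutive; ε⁻¹≈ε)
  open MonoidMult +-monoid using (×-homo-+) renaming (_×_ to _·_)
  open SemiringMult semiring using (×1-homo-*)
  open SemiringSolver commutativeSemiring using (solve; _:=_; _:+_)
  open SetoidReasoning setoid

  private
    ι : ℤ → Carrier
    ι = fromℤ rawRing

  fromℤ-neg : ∀ i → ι (ℤ.- i) ≈ - ι i
  fromℤ-neg (+ zero)   = sym ε⁻¹≈ε
  fromℤ-neg (+ suc n)  = refl
  fromℤ-neg -[1+ n ]   = sym (⁻¹-involutive _)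

  -- Sums of integers of opposite sign compute to `⊖`, so this supplies the mixed cases of
  -- `fromℤ-+`. The induction removes one `1#` from each side.
  fromℤ-⊖ : ∀ m n → ι (m ℤ.⊖ n) ≈ m · 1# + - (n · 1#)
  fromℤ-⊖ zero    zero    = sym (-‿inverseʳ _)
  fromℤ-⊖ zero    (suc n) = sym (+-identityˡ _)
  fromℤ-⊖ (suc m) zero    = sym (trans (+-congˡ ε⁻¹≈ε) (+-identityʳ _))
  fromℤ-⊖ (suc m) (suc n) = begin
    ι (suc m ℤ.⊖ suc n)                          ≡⟨ ≡.cong ι (ℤₚ.[1+m]⊖[1+n]≡m⊖n m n) ⟩
    ι (m ℤ.⊖ n)                                  ≈⟨ fromℤ-⊖ m n ⟩
    m · 1# + - (n · 1#)                          ≈⟨ +-identityˡ _ ⟨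
    0# + (m · 1# + - (n · 1#))                   ≈⟨ +-congʳ (-‿inverseʳ 1#) ⟨
    (1# + - 1#) + (m · 1# + - (n · 1#))          ≈⟨ solve 4 (λ a b x y → (a :+ b) :+ (x :+ y) := (a :+ x) :+ (b :+ y)) refl _ _ _ _ ⟩
    (1# + m · 1#) + (- 1# + - (n · 1#))          ≈⟨ +-congˡ (⁻¹-∙-comm _ _) ⟩
    (1# + m · 1#) + - (1# + n · 1#)              ∎

  fromℤ-+ : ∀ i j → ι (i ℤ.+ j) ≈ ι i + ι j
  fromℤ-+ (+ m)    (+ n)    = ×-homo-+ 1# m n
  fromℤ-+ (+ m)    -[1+ n ] = fromℤ-⊖ m (suc n)
  fromℤ-+ -[1+ m ] (+ n)    = trans (fromℤ-⊖ n (suc m)) (+-comm _ _)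
  fromℤ-+ -[1+ m ] -[1+ n ] = begin
    -- The sum of -(1+m) and -(1+n) is -(2+m+n), hence the two successors.
    - (suc (suc (m ℕ.+ n)) · 1#)     ≈⟨ -‿cong (×-homo-+ 1# (suc (suc m)) n) ⟩
    - (suc (suc m) · 1# + n · 1#)    ≈⟨ -‿cong (solve 3 (λ a x y → (a :+ (a :+ x)) :+ y := (a :+ x) :+ (a :+ y)) refl _ _ _) ⟩
    - (suc m · 1# + suc n · 1#)      ≈⟨ ⁻¹-∙-comm _ _ ⟨
    - (suc m · 1#) + - (suc n · 1#)  ∎

  private
    -- Integer multiplication goes through sign and absolute value, so the products in `fromℤ-*`
    -- appear as `◃` terms.
    fromℤ-pos◃ : ∀ n → ι (Sign.+ ℤ.◃ n) ≈ n · 1#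
    fromℤ-pos◃ n = reflexive (≡.cong ι (ℤₚ.+◃n≡+n n))

    fromℤ-neg◃ : ∀ n → ι (Sign.- ℤ.◃ n) ≈ - (n · 1#)
    fromℤ-neg◃ n = trans (reflexive (≡.cong ι (ℤₚ.-◃n≡-n n))) (fromℤ-neg (+ n))

  fromℤ-* : ∀ i j → ι (i ℤ.* j) ≈ ι i * ι j
  fromℤ-* (+ m)    (+ n)    = trans (fromℤ-pos◃ (m ℕ.* n)) (×1-homo-* m n)
  fromℤ-* (+ m)    -[1+ n ] = begin
    ι (Sign.- ℤ.◃ (m ℕ.* suc n))   ≈⟨ fromℤ-neg◃ (m ℕ.* suc n) ⟩
    - ((m ℕ.* suc n) · 1#)         ≈⟨ -‿cong (×1-homo-* m (suc n)) ⟩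
    - (m · 1# * (suc n · 1#))      ≈⟨ -‿distribʳ-* _ _ ⟩
    m · 1# * - (suc n · 1#)        ∎
  fromℤ-* -[1+ m ] (+ n)    = begin
    ι (Sign.- ℤ.◃ (suc m ℕ.* n))   ≈⟨ fromℤ-neg◃ (suc m ℕ.* n) ⟩
    - ((suc m ℕ.* n) · 1#)         ≈⟨ -‿cong (×1-homo-* (suc m) n) ⟩
    - (suc m · 1# * (n · 1#))      ≈⟨ -‿distribˡ-* _ _ ⟩
    - (suc m · 1#) * n · 1#        ∎
  fromℤ-* -[1+ m ] -[1+ n ] = begin
    (suc m ℕ.* suc n) · 1#             ≈⟨ ×1-homo-* (suc m) (suc n) ⟩
    suc m · 1# * (suc n · 1#)          ≈⟨ ⁻¹-involutive _ ⟨
    - - (suc m · 1# * (suc n · 1#))    ≈⟨ -‿cong (-‿distribʳ-* _ _) ⟩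
    - (suc m · 1# * - (suc n · 1#))    ≈⟨ -‿distribˡ-* _ _ ⟩
    - (suc m · 1#) * - (suc n · 1#)    ∎

  fromℤ-isRingHomomorphism :
    RingMorphisms.IsRingHomomorphism ℤ.+-*-rawRing rawRing ι
  fromℤ-isRingHomomorphism = ringHomomorphism ℤ.+-*-rawRing R
    (λ i≡j → reflexive (≡.cong ι i≡j))
    fromℤ-+ fromℤ-* fromℤ-neg refl (+-identityʳ 1#)

  open RawSemiringDefs (RawRing.rawSemiring rawRing) using (_^_)

  fromℤ-^ : ∀ i n → ι (i ℤ.^ n) ≈ ι i ^ n
  fromℤ-^ i zero    = +-identityʳ 1#
  fromℤ-^ i (suc n) = trans (fromℤ-* i (i ℤ.^ n)) (*-congˡ (fromℤ-^ i n))

-- Evaluation of polynomials along a ring homomorphism.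

module _ {R : RawRing c ℓ} (S : CommutativeRing c′ ℓ′)
  {f : RawRing.Carrier R → CommutativeRing.Carrier S}
  (f-hom : RingMorphisms.IsRingHomomorphism R (CommutativeRing.rawRing S) f)
  where

  private
    module R = RawRing R
    module f = RingMorphisms.IsRingHomomorphism f-hom
  open CommutativeRing S
  open RingProperties ring using (-‿distribʳ-*)
  open AbelianGroupProperties +-abelianGroup using (⁻¹-∙-comm; ε⁻¹≈ε)
  open SemiringSolver commutativeSemiring using (solve; _:=_; _:+_; _:*_)
  open SetoidReasoning setoid

  -- The images of integers are built from 1 by addition and negation alone, and `f` preserves all
  -- of these.
  fromℤ-homo : ∀ i → f (fromℤ R i) ≈ fromℤ rawRing i
  fromℤ-homo (+ n)    = natural n
    where
    natural : ∀ n → f (fromℤ R (+ n)) ≈ fromℤ rawRing (+ n)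
    natural zero    = f.0#-homo
    natural (suc n) = trans (f.+-homo _ _) (+-cong f.1#-homo (natural n))
  fromℤ-homo -[1+ n ] = trans (f.-‿homo _) (-‿cong (fromℤ-homo (+ suc n)))

  -- The coefficient maps `g` and `g′` are arbitrary so that the lemma can be applied twice, first
  -- to the inner polynomials in s and then to the outer polynomial in t.
  evalPoly-homo : {C : Set} {g : C → R.Carrier} {g′ : C → Carrier} →
    (∀ a → f (g a) ≈ g′ a) → ∀ {x x′} → f x ≈ x′ →
    ∀ Q → f (evalPoly R g x Q) ≈ evalPoly rawRing g′ x′ Q
  evalPoly-homo fg≈g′ fx≈x′ []      = f.0#-homo
  evalPoly-homo fg≈g′ fx≈x′ (a ∷ Q) = trans (f.+-homo _ _) (+-cong (fg≈g′ a)
    (trans (f.*-homo _ _) (*-cong fx≈x′ (evalPoly-homo fg≈g′ fx≈x′ Q))))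

  -- Used in two ways: with `f` the map from ℤ, to carry integer values of an atom into an algebra,
  -- and with `f` an evaluation of `R [X,Y]`, to substitute elements for α and β.
  eval-homo : ∀ Q x y {x′ y′} → f x ≈ x′ → f y ≈ y′ →
    f (eval R Q x y) ≈ eval rawRing Q x′ y′
  eval-homo Q x y fx≈x′ fy≈y′ =
    evalPoly-homo (evalPoly-homo fromℤ-homo fx≈x′) fy≈y′ Q

  -- Coefficients are sent through `f`. As `R [X,Y]` is `(R [X]) [X]`, evaluating in two variables
  -- is this construction iterated, the inner evaluation serving as the `f` of the outer one.
  evalAt : Carrier → List R.Carrier → Carrier
  evalAt x = foldr (λ a r → f a + x * r) 0#

  module _ (x : Carrier) where
    private
      e = evalAt x

      ∷-zero : ∀ {a r} → f a ≈ 0# → r ≈ 0# → f a + x * r ≈ 0#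
      ∷-zero a≈0 r≈0 =
        trans (+-cong a≈0 (trans (*-congˡ r≈0) (zeroʳ x))) (+-identityʳ 0#)

    -- Equal polynomials may be lists of different lengths. The excess coefficients are equal to
    -- zero, and comparing the remaining tail with `[]` shows that they contribute nothing.
    evalAt-cong : ∀ {p q} → (∀ n → coeff R p n R.≈ coeff R q n) → e p ≈ e q
    evalAt-cong {[]}    {[]}    p≈q = refl
    evalAt-cong {[]}    {b ∷ q} p≈q = sym (∷-zero
      (trans (sym (f.⟦⟧-cong (p≈q 0))) f.0#-homo)
      (sym (evalAt-cong {[]} {q} (λ n → p≈q (suc n)))))
    evalAt-cong {a ∷ p} {[]}    p≈q = ∷-zero
      (trans (f.⟦⟧-cong (p≈q 0)) f.0#-homo)
      (evalAt-cong {p} {[]} (λ n → p≈q (suc n)))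
    evalAt-cong {a ∷ p} {b ∷ q} p≈q = +-cong (f.⟦⟧-cong (p≈q 0))
      (*-congˡ (evalAt-cong {p} {q} (λ n → p≈q (suc n))))

    evalAt-+ : ∀ p q → e (addPoly R p q) ≈ e p + e q
    evalAt-+ []      q       = sym (+-identityˡ _)
    evalAt-+ (a ∷ p) []      = sym (+-identityʳ _)
    evalAt-+ (a ∷ p) (b ∷ q) = begin
      f (a R.+ b) + x * e (addPoly R p q)    ≈⟨ +-cong (f.+-homo a b) (*-congˡ (evalAt-+ p q)) ⟩
      f a + f b + x * (e p + e q)            ≈⟨ solve 5 (λ a b x p q → a :+ b :+ x :* (p :+ q) := (a :+ x :* p) :+ (b :+ x :* q)) refl _ _ _ _ _ ⟩
      (f a + x * e p) + (f b + x * e q)      ∎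

    evalAt-scale : ∀ a q → e (map (a R.*_) q) ≈ f a * e q
    evalAt-scale a []      = sym (zeroʳ _)
    evalAt-scale a (b ∷ q) = begin
      f (a R.* b) + x * e (map (a R.*_) q)  ≈⟨ +-cong (f.*-homo a b) (*-congˡ (evalAt-scale a q)) ⟩
      f a * f b + x * (f a * e q)           ≈⟨ solve 4 (λ a b x q → a :* b :+ x :* (a :* q) := a :* (b :+ x :* q)) refl _ _ _ _ ⟩
      f a * (f b + x * e q)                 ∎

    evalAt-* : ∀ p q → e (mulPoly R p q) ≈ e p * e q
    evalAt-* []      q = sym (zeroˡ _)
    evalAt-* (a ∷ p) q = begin
      e (addPoly R (map (a R.*_) q) (R.0# ∷ mulPoly R p q))  ≈⟨ evalAt-+ (map (a R.*_) q) _ ⟩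
      e (map (a R.*_) q) + (f R.0# + x * e (mulPoly R p q))  ≈⟨ +-cong (evalAt-scale a q) (+-cong f.0#-homo (*-congˡ (evalAt-* p q))) ⟩
      f a * e q + (0# + x * (e p * e q))                     ≈⟨ +-congˡ (+-identityˡ _) ⟩
      f a * e q + x * (e p * e q)                            ≈⟨ solve 4 (λ a x p q → a :* q :+ x :* (p :* q) := (a :+ x :* p) :* q) refl _ _ _ _ ⟩
      (f a + x * e p) * e q                                  ∎

    evalAt-neg : ∀ p → e (map R.-_ p) ≈ - e p
    evalAt-neg []      = sym ε⁻¹≈ε
    evalAt-neg (a ∷ p) = begin
      f (R.- a) + x * e (map R.-_ p)  ≈⟨ +-cong (f.-‿homo a) (*-congˡ (evalAt-neg p)) ⟩
      - f a + x * - e p               ≈⟨ +-congˡ (-‿distribʳ-* x (e p)) ⟨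
      - f a + - (x * e p)             ≈⟨ ⁻¹-∙-comm _ _ ⟩
      - (f a + x * e p)               ∎

    evalAt-const : ∀ a → e (a ∷ []) ≈ f a
    evalAt-const a = trans (+-congˡ (zeroʳ x)) (+-identityʳ _)

    evalAt-isRingHomomorphism :
      RingMorphisms.IsRingHomomorphism (R [X]) rawRing e
    evalAt-isRingHomomorphism = ringHomomorphism (R [X]) S
      (λ {p} {q} → evalAt-cong {p} {q}) evalAt-+ evalAt-* evalAt-neg refl
      (trans (evalAt-const R.1#) f.1#-homo)

-- R[X]/(X² − s X − t), the pair (a , b) being the class of a + b X.
module QuadraticExtension (R : CommutativeRing c ℓ) (s t : CommutativeRing.Carrier R) where
  open CommutativeRing R
  open SemiringSolver commutativeSemiring using (solve; _:=_; _:+_; _:*_)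
  open RingProperties ring using (-1*x≈-x)

  private
    additive : AbelianGroup _ _
    additive = DirectProduct.abelianGroup +-abelianGroup +-abelianGroup
    module A = AbelianGroup additive

    -- The product of a + b X and c + d X, reduced by X² = s X + t.
    _⊗_ : Carrier × Carrier → Carrier × Carrier → Carrier × Carrier
    (a , b) ⊗ (c , d) = a * c + t * (b * d) , a * d + b * c + s * (b * d)

    ⊗-comm : ∀ x y → (x ⊗ y) A.≈ (y ⊗ x)
    ⊗-comm (a , b) (c , d) =
      solve 5 (λ t a b c d → a :* c :+ t :* (b :* d) := c :* a :+ t :* (d :* b)) refl t a b c d ,
      solve 5 (λ s a b c d → a :* d :+ b :* c :+ s :* (b :* d) := c :* b :+ d :* a :+ s :* (d :* b)) refl s a b c d

    ⊗-identityˡ : ∀ x → ((1# , 0#) ⊗ x) A.≈ x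
    ⊗-identityˡ (a , b) =
      trans (+-cong (*-identityˡ a) (trans (*-congˡ (zeroˡ b)) (zeroʳ t))) (+-identityʳ a) ,
      trans (+-cong (trans (+-cong (*-identityˡ b) (zeroˡ a)) (+-identityʳ b))
        (trans (*-congˡ (zeroˡ b)) (zeroʳ s))) (+-identityʳ b)

    ⊗-distribˡ : ∀ x y z → (x ⊗ (y A.∙ z)) A.≈ ((x ⊗ y) A.∙ (x ⊗ z))
    ⊗-distribˡ (a , b) (c , d) (u , v) =
      solve 7 (λ t a b c d u v →
        a :* (c :+ u) :+ t :* (b :* (d :+ v)) :=
        (a :* c :+ t :* (b :* d)) :+ (a :* u :+ t :* (b :* v)))
        refl t a b c d u v ,
      solve 7 (λ s a b c d u v →
        a :* (d :+ v) :+ b :* (c :+ u) :+ s :* (b :* (d :+ v)) :=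
        (a :* d :+ b :* c :+ s :* (b :* d)) :+ (a :* v :+ b :* u :+ s :* (b :* v)))
        refl s a b c d u v

    ⊗-assoc : ∀ x y z → ((x ⊗ y) ⊗ z) A.≈ (x ⊗ (y ⊗ z))
    ⊗-assoc (a , b) (c , d) (u , v) =
      solve 8 (λ s t a b c d u v →
        (a :* c :+ t :* (b :* d)) :* u :+ t :* ((a :* d :+ b :* c :+ s :* (b :* d)) :* v) :=
        a :* (c :* u :+ t :* (d :* v)) :+ t :* (b :* (c :* v :+ d :* u :+ s :* (d :* v))))
        refl s t a b c d u v ,
      solve 8 (λ s t a b c d u v →
        (a :* c :+ t :* (b :* d)) :* v :+ (a :* d :+ b :* c :+ s :* (b :* d)) :* u
          :+ s :* ((a :* d :+ b :* c :+ s :* (b :* d)) :* v) :=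
        a :* (c :* v :+ d :* u :+ s :* (d :* v)) :+ b :* (c :* u :+ t :* (d :* v))
          :+ s :* (b :* (c :* v :+ d :* u :+ s :* (d :* v))))
        refl s t a b c d u v

  quadraticExtension : CommutativeRing _ _
  quadraticExtension = record
    { _*_ = _⊗_
    ; 1# = 1# , 0#
    ; isCommutativeRing = record
      { isRing = record
        { +-isAbelianGroup = A.isAbelianGroup
        ; *-cong = λ (a≈ , b≈) (c≈ , d≈) →
            +-cong (*-cong a≈ c≈) (*-congˡ (*-cong b≈ d≈)) ,
            +-cong (+-cong (*-cong a≈ d≈) (*-cong b≈ c≈)) (*-congˡ (*-cong b≈ d≈))
        ; *-assoc = ⊗-assoc
        ; *-identity = ⊗-identityˡ , comm∧idˡ⇒idʳ A.setoid ⊗-comm ⊗-identityˡ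
        ; distrib = ⊗-distribˡ , comm∧distrˡ⇒distrʳ A.setoid A.∙-cong ⊗-comm ⊗-distribˡ
        }
      ; *-comm = ⊗-comm
      }
    }

  private
    module Q = CommutativeRing quadraticExtension

  embed : Carrier → Q.Carrier
  embed a = a , 0#

  embed-isRingHomomorphism :
    RingMorphisms.IsRingHomomorphism rawRing Q.rawRing embed
  embed-isRingHomomorphism = ringHomomorphism rawRing quadraticExtension
    (λ a≈b → a≈b , refl)
    (λ _ _ → refl , sym (+-identityʳ 0#))
    (λ a b →
      sym (trans (+-congˡ (trans (*-congˡ (zeroʳ 0#)) (zeroʳ t))) (+-identityʳ _)) ,
      sym (trans (+-cong (trans (+-cong (zeroʳ a) (zeroˡ b)) (+-identityʳ 0#))
        (trans (*-congˡ (zeroʳ 0#)) (zeroʳ s))) (+-identityʳ 0#)))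
    (λ _ → refl , sym ε⁻¹≈ε)
    Q.refl Q.refl
    where open GroupProperties +-group using (ε⁻¹≈ε)

  -- X and s - X, the two roots of the defining quadratic; they play the roles of α and β.
  root conjugateRoot : Q.Carrier
  root          = 0# , 1#
  conjugateRoot = s , - 1#

  root-sum : (root Q.+ conjugateRoot) Q.≈ embed s
  root-sum = +-identityˡ s , -‿inverseʳ 1#

  root-product : (Q.- (root Q.* conjugateRoot)) Q.≈ embed t
  root-product = trans (-‿cong lhs) (⁻¹-involutive t) , trans (-‿cong rhs) ε⁻¹≈ε
    where
    open GroupProperties +-group using (⁻¹-involutive; ε⁻¹≈ε)
    -- The two coordinates of X (s - X) = s X - X² = -t.
    lhs : 0# * s + t * (1# * - 1#) ≈ - t
    lhs = trans (+-cong (zeroˡ s) (trans (*-congˡ (*-identityˡ _))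
      (trans (*-comm t _) (-1*x≈-x t)))) (+-identityˡ _)
    rhs : 0# * - 1# + 1# * s + s * (1# * - 1#) ≈ 0#
    rhs = trans (+-cong (trans (+-cong (zeroˡ _) (*-identityˡ s)) (+-identityˡ s))
      (trans (*-congˡ (*-identityˡ _)) (trans (*-comm s _) (-1*x≈-x s)))) (-‿inverseʳ s)

-- Products of linear factors.

module LinearFactors (S : CommutativeRing c ℓ) where
  open CommutativeRing S
  open RawSemiringDefs (RawRing.rawSemiring rawRing) using (_^_)
  open RingProperties ring using (-‿distribʳ-*)
  open AbelianGroupProperties +-abelianGroup using (ε⁻¹≈ε)
  open SemiringSolver commutativeSemiring using (solve; _:=_; _:+_; _:*_)
  open SetoidReasoning setoid

  linearFactors : (ℕ → Carrier) → Carrier → Carrier → List ℕ → Carrier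
  linearFactors γ x y js = foldr _*_ 1# (map (λ j → x + - (γ j * y)) js)

  -- Each factor is linear in (x, y), so it releases one `l`; the coefficients `γ j` may be
  -- anything.
  linearFactors-homogeneous : ∀ γ l x y js →
    linearFactors γ (l * x) (l * y) js ≈ l ^ length js * linearFactors γ x y js
  linearFactors-homogeneous γ l x y []       = sym (*-identityˡ 1#)
  linearFactors-homogeneous γ l x y (j ∷ js) = begin
    (l * x + - (γ j * (l * y))) * linearFactors γ (l * x) (l * y) js
      ≈⟨ *-cong factor (linearFactors-homogeneous γ l x y js) ⟩
    l * (x + - (γ j * y)) * (l ^ length js * linearFactors γ x y js)
      ≈⟨ solve 4 (λ l a b c → l :* a :* (b :* c) := l :* b :* (a :* c)) refl _ _ _ _ ⟩
    l * l ^ length js * ((x + - (γ j * y)) * linearFactors γ x y js) ∎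
    where
    factor : l * x + - (γ j * (l * y)) ≈ l * (x + - (γ j * y))
    factor = begin
      l * x + - (γ j * (l * y))  ≈⟨ +-congˡ (-‿cong (solve 3 (λ l g y → g :* (l :* y) := l :* (g :* y)) refl _ _ _)) ⟩
      l * x + - (l * (γ j * y))  ≈⟨ +-congˡ (-‿distribʳ-* l _) ⟩
      l * x + l * - (γ j * y)    ≈⟨ distribˡ l x _ ⟨
      l * (x + - (γ j * y))      ∎

  linearFactors-0 : ∀ γ x js → linearFactors γ x 0# js ≈ x ^ length js
  linearFactors-0 γ x []       = refl
  linearFactors-0 γ x (j ∷ js) = *-cong
    (trans (+-congˡ (trans (-‿cong (zeroʳ (γ j))) ε⁻¹≈ε)) (+-identityʳ x))
    (linearFactors-0 γ x js)

-- The defining identity, evaluated in an algebra.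

-- What the field `Pₙ` of `AreLucasAtoms` asserts for a single index, root and polynomial.
AtomIdentity : (R : RawRing c ℓ) → RawRing.Carrier R → ℕ → List (List ℤ) → Set ℓ
AtomIdentity R ω n Q =
  eval (R [X,Y]) Q (varX R + varY R) (- (varX R * varY R)) ≈ Φ R ω n
  where open RawRing (R [X,Y])

module _ {R : RawRing c ℓ} (S : CommutativeRing c′ ℓ′)
  {f : RawRing.Carrier R → CommutativeRing.Carrier S}
  (f-hom : RingMorphisms.IsRingHomomorphism R (CommutativeRing.rawRing S) f)
  where
  open CommutativeRing S
  open LinearFactors S
  open RawSemiringDefs (RawRing.rawSemiring R) using () renaming (_^_ to _^ᴿ_)
  private
    module R = RawRing R
    module R[X,Y] = RawRing (R [X,Y])

    α = varX R
    β = varY R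

  -- Both sides of the identity are mapped into S by the substitution of x for α and y for β. This
  -- is a ring homomorphism, so it turns the left side into a value of Q and the right side into a
  -- product of linear factors.
  eval-Φ : ∀ {ω n Q} → AtomIdentity R ω n Q →
    ∀ x y → eval rawRing Q (x + y) (- (x * y)) ≈
      linearFactors (λ j → f (ω ^ᴿ j)) x y (coprimesUpTo n)
  eval-Φ {ω} {n} {Q} Q≈Φ x y = begin
    eval rawRing Q (x + y) (- (x * y))
      ≈⟨ eval-homo S e₂-hom Q (α R[X,Y].+ β) (R[X,Y].- (α R[X,Y].* β))
           (trans (e₂.+-homo α β) (+-cong e-varX e-varY))
           (trans (e₂.-‿homo (α R[X,Y].* β))
             (-‿cong (trans (e₂.*-homo α β) (*-cong e-varX e-varY)))) ⟨
    e₂ (eval (R [X,Y]) Q (α R[X,Y].+ β) (R[X,Y].- (α R[X,Y].* β)))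
      ≈⟨ e₂.⟦⟧-cong {eval (R [X,Y]) Q (α R[X,Y].+ β) (R[X,Y].- (α R[X,Y].* β))} {Φ R ω n} Q≈Φ ⟩
    e₂ (Φ R ω n)
      ≈⟨ product (coprimesUpTo n) ⟩
    linearFactors (λ j → f (ω ^ᴿ j)) x y (coprimesUpTo n) ∎
    where
    open SetoidReasoning setoid
    -- The inner variable α is evaluated first, then the outer variable β.
    e₁-hom = evalAt-isRingHomomorphism S f-hom x
    e₂-hom = evalAt-isRingHomomorphism S e₁-hom y
    module f  = RingMorphisms.IsRingHomomorphism f-hom
    module e₁ = RingMorphisms.IsRingHomomorphism e₁-hom
    module e₂ = RingMorphisms.IsRingHomomorphism e₂-hom
    e₂ = evalAt S e₁-hom y

    variable-value : ∀ z {a b} → a ≈ 0# → b ≈ 1# → a + z * b ≈ z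
    variable-value z a≈0 b≈1 =
      trans (+-cong a≈0 (trans (*-congˡ b≈1) (*-identityʳ z))) (+-identityˡ z)

    e-varX : e₂ α ≈ x
    e-varX = trans (evalAt-const S e₁-hom y (R.0# ∷ R.1# ∷ []))
      (variable-value x f.0#-homo (trans (evalAt-const S f-hom x R.1#) f.1#-homo))

    e-varY : e₂ β ≈ y
    e-varY = variable-value y refl
      (trans (evalAt-const S e₁-hom y (R.1# ∷ [])) e₁.1#-homo)

    e-const : ∀ a → e₂ (const R a) ≈ f a
    e-const a = trans (evalAt-const S e₁-hom y (a ∷ [])) (evalAt-const S f-hom x a)

    factor : ℕ → List (List R.Carrier)
    factor j = α R[X,Y].+ (R[X,Y].- (const R (ω ^ᴿ j) R[X,Y].* β))

    e-factor : ∀ j → e₂ (factor j) ≈ x + - (f (ω ^ᴿ j) * y)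
    e-factor j = begin
      e₂ (factor j)
        ≈⟨ e₂.+-homo α (R[X,Y].- (const R (ω ^ᴿ j) R[X,Y].* β)) ⟩
      e₂ α + e₂ (R[X,Y].- (const R (ω ^ᴿ j) R[X,Y].* β))
        ≈⟨ +-cong e-varX (e₂.-‿homo (const R (ω ^ᴿ j) R[X,Y].* β)) ⟩
      x + - e₂ (const R (ω ^ᴿ j) R[X,Y].* β)
        ≈⟨ +-congˡ (-‿cong (e₂.*-homo (const R (ω ^ᴿ j)) β)) ⟩
      x + - (e₂ (const R (ω ^ᴿ j)) * e₂ β)
        ≈⟨ +-congˡ (-‿cong (*-cong (e-const (ω ^ᴿ j)) e-varY)) ⟩
      x + - (f (ω ^ᴿ j) * y) ∎

    product : ∀ js → e₂ (foldr R[X,Y]._*_ R[X,Y].1# (map factor js))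
      ≈ linearFactors (λ j → f (ω ^ᴿ j)) x y js
    product []       = e₂.1#-homo
    product (j ∷ js) = trans
      (e₂.*-homo (factor j) (foldr R[X,Y]._*_ R[X,Y].1# (map factor js)))
      (*-cong (e-factor j) (product js))

-- Descent to the integers.

-- Stated through `fromℤ`, whose value at `+ suc n` unfolds to the multiple of 1 in
-- `CharacteristicZero`, and for any commutative ring, so that it also covers the quadratic
-- extension.
HasCharacteristicZero : CommutativeRing c ℓ → Set ℓ
HasCharacteristicZero R = ∀ n → ¬ (fromℤ rawRing (+ suc n) ≈ 0#)
  where open CommutativeRing R

-- The kernel is trivial, and i - j lies in it. A negative integer in the kernel would put its
-- positive opposite there too.
fromℤ-injective : (R : CommutativeRing c ℓ) → HasCharacteristicZero R →
  ∀ {i j} → CommutativeRing._≈_ R (fromℤ (CommutativeRing.rawRing R) i)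
                                   (fromℤ (CommutativeRing.rawRing R) j) → i ≡ j
fromℤ-injective R char0 {i} {j} ιi≈ιj = ℤₚ.i-j≡0⇒i≡j i j (kernel (i ℤ.- j) (begin
    ι (i ℤ.+ ℤ.- j)  ≈⟨ fromℤ-+ i (ℤ.- j) ⟩
    ι i + ι (ℤ.- j)  ≈⟨ +-cong ιi≈ιj (fromℤ-neg j) ⟩
    ι j + - ι j      ≈⟨ -‿inverseʳ _ ⟩
    0#               ∎))
  where
  open CommutativeRing R
  open FromℤHomomorphism R
  open SetoidReasoning setoid
  open GroupProperties +-group using (⁻¹-injective; ε⁻¹≈ε)
  ι = fromℤ rawRing
  kernel : ∀ k → ι k ≈ 0# → k ≡ + 0
  kernel (+ zero)  _    = ≡.refl
  kernel (+ suc n) ιk≈0 = contradiction ιk≈0 (char0 n)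
  kernel -[1+ n ]  ιk≈0 = contradiction (⁻¹-injective (trans ιk≈0 (sym ε⁻¹≈ε))) (char0 n)

-- Two integer identities for the atoms.

module _ (R : CommutativeRing c ℓ) (char0 : HasCharacteristicZero R) {ω n Q}
  (Q≈Φ : AtomIdentity (CommutativeRing.rawRing R) ω n Q)
  where
  private
    module R = CommutativeRing R

  -- Take α = s and β = 0: then α+β = s, -αβ = 0, and each of the φ(n) factors equals s.
  atom-at-t=0 : ∀ s → evalℤ Q s (+ 0) ≡ s ℤ.^ φ n
  atom-at-t=0 s = fromℤ-injective R char0 (begin
    ι (evalℤ Q s (+ 0))
      ≈⟨ eval-homo R fromℤ-isRingHomomorphism Q s (+ 0) (R.sym (R.+-identityʳ _)) (R.sym minus-zero) ⟩
    eval R.rawRing Q (ι s R.+ R.0#) (R.- (ι s R.* R.0#))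
      ≈⟨ eval-Φ R (isRingHomomorphism R.rawRing R.refl) {ω} {n} {Q} Q≈Φ (ι s) R.0# ⟩
    linearFactors _ (ι s) R.0# (coprimesUpTo n)
      ≈⟨ linearFactors-0 _ (ι s) (coprimesUpTo n) ⟩
    ι s ^ φ n
      ≈⟨ fromℤ-^ s (φ n) ⟨
    ι (s ℤ.^ φ n) ∎)
    where
    open FromℤHomomorphism R
    open LinearFactors R
    open RawSemiringDefs (RawRing.rawSemiring R.rawRing) using (_^_)
    open SetoidReasoning R.setoid
    open GroupProperties R.+-group using (ε⁻¹≈ε)
    ι = fromℤ R.rawRing
    minus-zero : R.- (ι s R.* R.0#) R.≈ R.0#
    minus-zero = R.trans (R.-‿cong (R.zeroʳ _)) ε⁻¹≈ε

  -- α and β need not exist in R; they do in R[X]/(X² − s X − t).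
  atom-homogeneous : ∀ l s t →
    evalℤ Q (l ℤ.* s) (l ℤ.* l ℤ.* t) ≡ l ℤ.^ φ n ℤ.* evalℤ Q s t
  atom-homogeneous l s t = fromℤ-injective S S-char0 (begin
    ι (evalℤ Q (l ℤ.* s) (l ℤ.* l ℤ.* t))
      ≈⟨ eval-homo S fromℤ-isRingHomomorphism Q (l ℤ.* s) (l ℤ.* l ℤ.* t) scaled-sum scaled-product ⟩
    eval S.rawRing Q (λ′ S.* root S.+ λ′ S.* conjugateRoot)
      (S.- (λ′ S.* root S.* (λ′ S.* conjugateRoot)))
      -- The identity holds at every pair of elements of S; it is used here at the scaled roots and
      -- below, in reverse, at the roots themselves.
      ≈⟨ eval-Φ S embed-isRingHomomorphism {ω} {n} {Q} Q≈Φ (λ′ S.* root) (λ′ S.* conjugateRoot) ⟩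
    linearFactors _ (λ′ S.* root) (λ′ S.* conjugateRoot) js
      ≈⟨ linearFactors-homogeneous _ λ′ root conjugateRoot js ⟩
    λ′ ^ φ n S.* linearFactors _ root conjugateRoot js
      ≈⟨ S.*-cong (fromℤ-^ l (φ n)) (eval-Φ S embed-isRingHomomorphism {ω} {n} {Q} Q≈Φ root conjugateRoot) ⟨
    ι (l ℤ.^ φ n) S.* eval S.rawRing Q (root S.+ conjugateRoot) (S.- (root S.* conjugateRoot))
      ≈⟨ S.*-congˡ (eval-homo S fromℤ-isRingHomomorphism Q s t sum-of-roots product-of-roots) ⟨
    ι (l ℤ.^ φ n) S.* ι (evalℤ Q s t)
      ≈⟨ fromℤ-* (l ℤ.^ φ n) (evalℤ Q s t) ⟨
    ι (l ℤ.^ φ n ℤ.* evalℤ Q s t) ∎)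
    where
    open QuadraticExtension R (fromℤ R.rawRing s) (fromℤ R.rawRing t)
    S = quadraticExtension
    module S = CommutativeRing S
    open FromℤHomomorphism S
    open LinearFactors S
    open RawSemiringDefs (RawRing.rawSemiring S.rawRing) using (_^_)
    open SetoidReasoning S.setoid
    open RingProperties S.ring using (-‿distribʳ-*)
    open CommutativeSemigroupProperties S.*-commutativeSemigroup using (interchange)
    js = coprimesUpTo n
    ι = fromℤ S.rawRing
    λ′ = ι l

    -- An integer in S is the embedded integer of R, so if it vanishes, its first coordinate already
    -- vanishes in R.
    S-char0 : HasCharacteristicZero S
    S-char0 m ιm≈0 = char0 m (proj₁ (S.trans
      (fromℤ-homo S embed-isRingHomomorphism (+ suc m)) ιm≈0))

    sum-of-roots : ι s S.≈ root S.+ conjugateRoot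
    sum-of-roots = S.sym (S.trans root-sum (fromℤ-homo S embed-isRingHomomorphism s))

    product-of-roots : ι t S.≈ S.- (root S.* conjugateRoot)
    product-of-roots = S.sym (S.trans root-product (fromℤ-homo S embed-isRingHomomorphism t))

    scaled-sum : ι (l ℤ.* s) S.≈ λ′ S.* root S.+ λ′ S.* conjugateRoot
    scaled-sum = S.trans (fromℤ-* l s)
      (S.trans (S.*-congˡ sum-of-roots) (S.distribˡ λ′ _ _))

    scaled-product : ι (l ℤ.* l ℤ.* t) S.≈
      S.- (λ′ S.* root S.* (λ′ S.* conjugateRoot))
    scaled-product = begin
      ι (l ℤ.* l ℤ.* t)                             ≈⟨ fromℤ-* (l ℤ.* l) t ⟩
      ι (l ℤ.* l) S.* ι t                           ≈⟨ S.*-cong (fromℤ-* l l) product-of-roots ⟩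
      λ′ S.* λ′ S.* S.- (root S.* conjugateRoot)     ≈⟨ -‿distribʳ-* _ _ ⟨
      S.- (λ′ S.* λ′ S.* (root S.* conjugateRoot))   ≈⟨ S.-‿cong (interchange _ _ _ _) ⟩
      S.- (λ′ S.* root S.* (λ′ S.* conjugateRoot))   ∎

-- Valuations at p.

open import Data.Nat using (_*_; _^_; _≤_; _<_)

m≤n⇒p^m∣p^n : ∀ p {m n} → m ≤ n → p ^ m ℕ∣.∣ p ^ n
m≤n⇒p^m∣p^n p {n = n} z≤n = ℕ∣.1∣ (p ^ n)
m≤n⇒p^m∣p^n p (s≤s m≤n)   = ℕ∣.*-monoʳ-∣ p (m≤n⇒p^m∣p^n p m≤n)

n<p^n : ∀ {p} → 1 < p → ∀ n → n < p ^ n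
n<p^n     1<p zero    = s≤s z≤n
n<p^n {p} 1<p (suc n) = ℕₚ.≤-<-trans (n<p^n 1<p n) (ℕₚ.^-monoʳ-< p 1<p (ℕₚ.n<1+n n))

maxExponent-∣ : ∀ p m N → p ^ maxExponent p m N ℕ∣.∣ m
maxExponent-∣ p m zero    = ℕ∣.1∣ m
maxExponent-∣ p m (suc N) with p ^ suc N ℕ∣.∣? m
... | yes p^N∣m = p^N∣m
... | no  _     = maxExponent-∣ p m N

maxExponent-maximal : ∀ p m {k} N → k ≤ N → p ^ k ℕ∣.∣ m → k ≤ maxExponent p m N
maxExponent-maximal p m zero    k≤0 p^k∣m = k≤0
maxExponent-maximal p m {k} (suc N) k≤N p^k∣m with p ^ suc N ℕ∣.∣? m
... | yes _     = k≤N
... | no  p^N∤m = maxExponent-maximal p m N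
  (ℕₚ.≤-pred (ℕₚ.≤∧≢⇒< k≤N λ { ≡.refl → p^N∤m p^k∣m })) p^k∣m

pos-^ : ∀ m n → + (m ^ n) ≡ (+ m) ℤ.^ n
pos-^ m zero    = ≡.refl
pos-^ m (suc n) = ≡.trans (ℤₚ.pos-* m (m ^ n)) (≡.cong (+ m ℤ.*_) (pos-^ m n))

module _ {p} (1<p : 1 < p) where

  -- Shows that the bounded search in `v` misses no exponent: k < p^k, and a divisor of a nonzero n
  -- is at most n.
  p^k∣n⇒k≤n : ∀ {k n} → .{{NonZero n}} → p ^ k ℕ∣.∣ n → k ≤ n
  p^k∣n⇒k≤n {k} p^k∣n = ℕₚ.<⇒≤ (ℕₚ.<-≤-trans (n<p^n 1<p k) (ℕ∣.∣⇒≤ p^k∣n))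

  -- An exponent found above k would make p^(k+1) a divisor of n.
  maxExponent-unique : ∀ {k n} → .{{NonZero n}} →
    p ^ k ℕ∣.∣ n → ¬ (p ^ suc k ℕ∣.∣ n) → maxExponent p n n ≡ k
  maxExponent-unique {k} {n} p^k∣n p^1+k∤n = ℕₚ.≤-antisym
    (ℕₚ.≮⇒≥ λ k<M → p^1+k∤n (ℕ∣.∣-trans (m≤n⇒p^m∣p^n p k<M) (maxExponent-∣ p n n)))
    (maxExponent-maximal p n n (p^k∣n⇒k≤n p^k∣n) p^k∣n)

  v-unique : ∀ {k} x → p ^ k ℕ∣.∣ ℤ.∣ x ∣ → ¬ (p ^ suc k ℕ∣.∣ ℤ.∣ x ∣) → v p x ≡ [ k ]
  -- Zero is excluded by the second hypothesis, as every power divides it.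
  v-unique (+ zero)  _     ∤0     = contradiction (_ ℕ∣.∣0) ∤0
  v-unique (+ suc n) p^k∣x p^1+k∤x = ≡.cong [_] (maxExponent-unique p^k∣x p^1+k∤x)
  v-unique -[1+ n ]  p^k∣x p^1+k∤x = ≡.cong [_] (maxExponent-unique p^k∣x p^1+k∤x)

  private
    instance
      p≢0 : NonZero p
      p≢0 = ℕ.>-nonZero (ℕₚ.<-trans (s≤s z≤n) 1<p)

  -- If a power beyond m + k divided p^m x, cancelling p^m would leave p^(k+1) dividing x, against
  -- the maximality of k.
  v-p^m*-nonzero : ∀ m x → .{{NonZero ℤ.∣ x ∣}} →
    v p (+ (p ^ m) ℤ.* x) ≡ [ m ℕ.+ maxExponent p ℤ.∣ x ∣ ℤ.∣ x ∣ ]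
  v-p^m*-nonzero m x = v-unique (+ (p ^ m) ℤ.* x)
    (≡.subst₂ ℕ∣._∣_ (≡.sym (ℕₚ.^-distribˡ-+-* p m k)) (≡.sym ∣p^m*x∣)
      (ℕ∣.*-monoʳ-∣ (p ^ m) (maxExponent-∣ p n n)))
    (λ p^1+m+k∣ → ℕₚ.1+n≰n (maxExponent-maximal p n n (p^k∣n⇒k≤n (cancel p^1+m+k∣)) (cancel p^1+m+k∣)))
    where
    n = ℤ.∣ x ∣
    k = maxExponent p n n
    ∣p^m*x∣ : ℤ.∣ + (p ^ m) ℤ.* x ∣ ≡ p ^ m * n
    ∣p^m*x∣ = ℤₚ.abs-* (+ (p ^ m)) x
    cancel : p ^ suc (m ℕ.+ k) ℕ∣.∣ ℤ.∣ + (p ^ m) ℤ.* x ∣ → p ^ suc k ℕ∣.∣ n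
    cancel = ℕ∣.*-cancelˡ-∣ (p ^ m) {{ℕₚ.m^n≢0 p m}} ∘
      ≡.subst₂ ℕ∣._∣_ (≡.trans (≡.cong (p ^_) (≡.sym (ℕₚ.+-suc m k)))
        (ℕₚ.^-distribˡ-+-* p m (suc k))) ∣p^m*x∣

  v-p^m* : ∀ m x → v p (+ (p ^ m) ℤ.* x) ≡ [ m ] +⁺ v p x
  -- Both sides are infinite.
  v-p^m* m (+ zero)  = ≡.cong (v p) (ℤₚ.*-zeroʳ (+ (p ^ m)))
  v-p^m* m (+ suc n) = v-p^m*-nonzero m (+ suc n)
  v-p^m* m -[1+ n ]  = v-p^m*-nonzero m -[1+ n ]

  v-p^a^m* : ∀ a m x → v p ((+ (p ^ a)) ℤ.^ m ℤ.* x) ≡ [ m * a ] +⁺ v p x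
  v-p^a^m* a m x = ≡.trans (≡.cong (λ q → v p (q ℤ.* x)) power) (v-p^m* (m * a) x)
    where
    power : (+ (p ^ a)) ℤ.^ m ≡ + (p ^ (m * a))
    power = ≡.trans (≡.sym (pos-^ (p ^ a) m)) (≡.cong +_
      (≡.trans (ℕₚ.^-*-assoc p a m) (≡.cong (p ^_) (ℕₚ.*-comm a m))))

  ∤⇒v≡0 : ∀ {x} → ¬ (+ p ∣ x) → v p x ≡ [ 0 ]
  ∤⇒v≡0 {x} p∤x = v-unique x (ℕ∣.1∣ _)
    (p∤x ∘ ≡.subst (ℕ∣._∣ ℤ.∣ x ∣) (ℕₚ.*-identityʳ p))

-- Divisibility by p and reduction modulo t.

prime-∤-^ : ∀ {p x} → Prime p → ¬ (+ p ∣ x) → ∀ n → ¬ (+ p ∣ x ℤ.^ n)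
prime-∤-^ {p} {x} p-prime p∤x zero    p∣1 =
  ℕ.nonTrivial⇒≢1 {{prime⇒nonTrivial p-prime}} (ℕ∣.∣1⇒≡1 p∣1)
prime-∤-^ {p} {x} p-prime p∤x (suc n) p∣x^1+n =
  [ p∤x , prime-∤-^ {x = x} p-prime p∤x n ]′
    (euclidsLemma ℤ.∣ x ∣ ℤ.∣ x ℤ.^ n ∣ p-prime
      (≡.subst (p ℕ∣.∣_) (ℤₚ.abs-* x (x ℤ.^ n)) p∣x^1+n))

-- Write Q = q + t Q′ with q a polynomial in s. As d divides both Q(s,t) and t, it divides q(s),
-- which is the value at t = 0.
evalℤ-mod-t : ∀ Q s {t d} → d Signed.∣ t → d Signed.∣ evalℤ Q s t → d Signed.∣ evalℤ Q s (+ 0)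
evalℤ-mod-t []      s d∣t d∣0 = d∣0
evalℤ-mod-t (q ∷ Q) s {t} {d} d∣t d∣Q = Signed.∣m∣n⇒∣m+n
  (Signed.∣m+n∣n⇒∣m {m = evalPoly ℤ.+-*-rawRing (fromℤ ℤ.+-*-rawRing) s q} d∣Q
    (Signed.∣m⇒∣m*n (evalℤ Q s t) d∣t))
  (Signed.∣m⇒∣m*n (evalℤ Q s (+ 0)) (Signed.divides (+ 0) ≡.refl))

-- The valuation of the atoms.

theorem16 :
    ∀ {c ℓ₁ ℓ₂} (K : FieldWithRootsOfUnity c ℓ₁ ℓ₂)
    (P : ℕ → RawRing.Carrier ℤ[s,t]) → FieldWithRootsOfUnity.LucasAtomPolynomials K P →
    ∀ (s t s′ t′ : ℤ) (p : ℕ) → Prime p →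
    ∀ (a : ℕ) (b : ℕ ⁺) → 1 ≤ a → [ 1 ] ≤⁺ b →
    s ≡ + (p ^ a) ℤ.* s′ → t ≡ p ^⁺ b ℤ.* t′ →
    ¬ (+ p ∣ s′ ℤ.* t′) →
    [ 2 * a ] ≤⁺ b →
    ∀ n → 2 ≤ n →
    ([ 2 * a ] <⁺ b → v p (evalℤ (P n) s t) ≡ [ φ n * a ])
    × (b ≡ [ 2 * a ] → v p (evalℤ (P n) s t) ≡ [ φ n * a ] +⁺ v p (evalℤ (P n) s′ t′))
theorem16 K P P-atoms s t s′ t′ p p-prime a b _ _ s≡ t≡ p∤s′t′ _ n 2≤n =
  above b t≡ , equal
  where
  open FieldWithRootsOfUnity K using (heytingField; characteristicZero; ζ)
  R = HeytingCommutativeRing.commutativeRing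
    (HeytingField.heytingCommutativeRing heytingField)
  Pₙ≈Φ = AreLucasAtoms.Pₙ P-atoms n 2≤n
  1<p = ℕ.nonTrivial⇒n>1 p {{prime⇒nonTrivial p-prime}}
  l = + (p ^ a)

  p∤s′ : ¬ (+ p ∣ s′)
  p∤s′ p∣s′ = p∤s′t′ (≡.subst (p ℕ∣.∣_) (≡.sym (ℤₚ.abs-* s′ t′)) (ℕ∣.∣m⇒∣m*n ℤ.∣ t′ ∣ p∣s′))

  l*l : + (p ^ (2 * a)) ≡ l ℤ.* l
  l*l = begin
    -- `2 * a` computes to `a + (a + 0)`.
    + (p ^ (2 * a))        ≡⟨ ≡.cong (λ m → + (p ^ (a ℕ.+ m))) (ℕₚ.+-identityʳ a) ⟩
    + (p ^ (a ℕ.+ a))      ≡⟨ ≡.cong +_ (ℕₚ.^-distribˡ-+-* p a a) ⟩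
    + (p ^ a * p ^ a)      ≡⟨ ℤₚ.pos-* (p ^ a) (p ^ a) ⟩
    l ℤ.* l                ∎
    where open ≡-Reasoning

  -- Serves both cases: u is t′ when b = 2a, and a multiple of p, possibly 0, when b > 2a.
  v-Pₙ : ∀ {u} → t ≡ l ℤ.* l ℤ.* u →
    v p (evalℤ (P n) s t) ≡ [ φ n * a ] +⁺ v p (evalℤ (P n) s′ u)
  v-Pₙ {u} t≡l²u = begin
    v p (evalℤ (P n) s t)                               ≡⟨ ≡.cong₂ (λ x y → v p (evalℤ (P n) x y)) s≡ t≡l²u ⟩
    v p (evalℤ (P n) (l ℤ.* s′) (l ℤ.* l ℤ.* u))        ≡⟨ ≡.cong (v p) (atom-homogeneous R characteristicZero {ζ n} {n} {P n} Pₙ≈Φ l s′ u) ⟩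
    v p (l ℤ.^ φ n ℤ.* evalℤ (P n) s′ u)                ≡⟨ v-p^a^m* 1<p a (φ n) (evalℤ (P n) s′ u) ⟩
    [ φ n * a ] +⁺ v p (evalℤ (P n) s′ u)               ∎
    where open ≡-Reasoning

  -- If p divided Pₙ(s′,u), reducing modulo p would make it divide Pₙ(s′,0) = s′^φ(n), hence s′.
  v-Pₙ-reduced : ∀ {u} → + p Signed.∣ u → v p (evalℤ (P n) s′ u) ≡ [ 0 ]
  v-Pₙ-reduced p∣u = ∤⇒v≡0 1<p λ p∣Pₙ →
    prime-∤-^ {x = s′} p-prime p∤s′ (φ n)
      (≡.subst (+ p ∣_) (atom-at-t=0 R characteristicZero {ζ n} {n} {P n} Pₙ≈Φ s′)
        (Signed.∣⇒∣ᵤ (evalℤ-mod-t (P n) s′ p∣u (Signed.∣ᵤ⇒∣ p∣Pₙ))))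

  above′ : ∀ {u} → + p Signed.∣ u → t ≡ l ℤ.* l ℤ.* u → v p (evalℤ (P n) s t) ≡ [ φ n * a ]
  above′ p∣u t≡l²u = ≡.trans (v-Pₙ t≡l²u) (≡.trans (≡.cong ([ φ n * a ] +⁺_) (v-Pₙ-reduced p∣u))
    (≡.cong [_] (ℕₚ.+-identityʳ (φ n * a))))

  above : ∀ b → t ≡ p ^⁺ b ℤ.* t′ → [ 2 * a ] <⁺ b → v p (evalℤ (P n) s t) ≡ [ φ n * a ]
  -- Here t = 0, so u = 0.
  above ⊤⁺    t≡0 _ = above′ {+ 0} (Signed.divides (+ 0) ≡.refl)
    (≡.trans t≡0 (≡.sym (ℤₚ.*-zeroʳ (l ℤ.* l))))
  above [ b ] t≡p^b*t′ 2a<b with ℕₚ.m≤n⇒∃[o]m+o≡n ([<]-injective 2a<b)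
  -- Now b = 2a + 1 + k, so u = p^(1+k) t′ keeps at least one factor p.
  ... | k , ≡.refl = above′ (Signed.∣m⇒∣m*n {m = + (p ^ suc k)} t′ (Signed.∣ᵤ⇒∣ (ℕ∣.m∣m*n (p ^ k)))) (begin
    t                                                   ≡⟨ t≡p^b*t′ ⟩
    + (p ^ (suc (2 * a) ℕ.+ k)) ℤ.* t′                  ≡⟨ ≡.cong (λ m → + (p ^ m) ℤ.* t′) (ℕₚ.+-suc (2 * a) k) ⟨
    + (p ^ (2 * a ℕ.+ suc k)) ℤ.* t′                    ≡⟨ ≡.cong (λ q → + q ℤ.* t′) (ℕₚ.^-distribˡ-+-* p (2 * a) (suc k)) ⟩
    + (p ^ (2 * a) * p ^ suc k) ℤ.* t′                  ≡⟨ ≡.cong (ℤ._* t′) (ℤₚ.pos-* (p ^ (2 * a)) (p ^ suc k)) ⟩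
    + (p ^ (2 * a)) ℤ.* + (p ^ suc k) ℤ.* t′            ≡⟨ ≡.cong (λ q → q ℤ.* + (p ^ suc k) ℤ.* t′) l*l ⟩
    l ℤ.* l ℤ.* + (p ^ suc k) ℤ.* t′                    ≡⟨ ℤₚ.*-assoc (l ℤ.* l) (+ (p ^ suc k)) t′ ⟩
    l ℤ.* l ℤ.* (+ (p ^ suc k) ℤ.* t′)                  ∎)
    where open ≡-Reasoning

  equal : b ≡ [ 2 * a ] → v p (evalℤ (P n) s t) ≡ [ φ n * a ] +⁺ v p (evalℤ (P n) s′ t′)
  equal ≡.refl = v-Pₙ (≡.trans t≡ (≡.cong (ℤ._* t′) l*l))
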